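{- Every ill-founded countable model of set theory $\langle M,\in^M\rangle$ is universal for all countable acyclic binary relations: for every countable set $G$ with an acyclic binary relation $\rightharpoonup$ on it, $\langle G,\rightharpoonup\rangle$ is isomorphic to a submodel of $\langle M,\in^M\rangle$.
   Context: A model of set theory is a first-order structure $\langle M,\in^M\rangle$ satisfying at least the Kripke–Platek axioms KP. It is ill-founded if the relation $\in^M$ is not well-founded (as judged externally). A binary relation $\rightharpoonup$ on $G$ is acyclic if there is no finite directed path (of length at least one) from a point of $G$ to itself. A submodel is an arbitrary subset with the restricted relation (an induced substructure). -}

module Defs where

open import Data.Empty using (⊥)
open import Data.Fin.Base using (Fin; zero; suc)
open import Data.Nat.Base using (ℕ; suc)
open import Data.Product.Base using (Σ; Σ-syntax; ∃-syntax; _×_; proj₁)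
open import Data.Sum.Base using (_⊎_)
open import Data.Vec.Base using (Vec; _∷_; lookup)
open import Function.Base using (_on_)
open import Function.Bundles using (_↣_; _⇔_)
open import Induction.WellFounded using (WellFounded)
open import Level using (0ℓ)
open import Relation.Binary.Construct.Closure.Transitive using (TransClosure)
open import Relation.Binary.Core using (Rel)
open import Relation.Binary.Morphism.Structures using (IsOrderIsomorphism)
open import Relation.Binary.PropositionalEquality.Core using (_≡_)
open import Relation.Nullary.Negation.Core using (¬_)
open import Relation.Unary using (Pred)

infix  8 _∈̇_ _≐_
infixr 7 _∧̇_
infixr 6 _∨̇_
infixr 5 _⇒̇_

-- First-order formulas in the language {∈, =}, with free variables the
-- de Bruijn indices in Fin n; negation is φ ⇒̇ ⊥̇.

data Formula (n : ℕ) : Set where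
  _∈̇_ _≐_         : Fin n → Fin n → Formula n
  ⊥̇               : Formula n
  _∧̇_ _∨̇_ _⇒̇_   : Formula n → Formula n → Formula n
  ∀̇ ∃̇             : Formula (suc n) → Formula n

-- In the bounded quantifiers the bound is a variable t of the outer context,
-- so it is never the quantified variable itself.

data Δ₀ {n : ℕ} : Formula n → Set where
  mem  : ∀ i j → Δ₀ (i ∈̇ j)
  eq   : ∀ i j → Δ₀ (i ≐ j)
  bot  : Δ₀ ⊥̇
  and  : ∀ {φ ψ} → Δ₀ φ → Δ₀ ψ → Δ₀ (φ ∧̇ ψ)
  or   : ∀ {φ ψ} → Δ₀ φ → Δ₀ ψ → Δ₀ (φ ∨̇ ψ)
  imp  : ∀ {φ ψ} → Δ₀ φ → Δ₀ ψ → Δ₀ (φ ⇒̇ ψ)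
  ball : ∀ t {φ} → Δ₀ φ → Δ₀ (∀̇ (zero ∈̇ suc t ⇒̇ φ))
  bex  : ∀ t {φ} → Δ₀ φ → Δ₀ (∃̇ (zero ∈̇ suc t ∧̇ φ))

module _ {M : Set} (_ε_ : Rel M 0ℓ) where

  Sat : ∀ {n} → Formula n → Vec M n → Set
  Sat (i ∈̇ j) ρ = lookup ρ i ε lookup ρ j
  Sat (i ≐ j) ρ = lookup ρ i ≡ lookup ρ j
  Sat ⊥̇       ρ = ⊥
  Sat (φ ∧̇ ψ) ρ = Sat φ ρ × Sat ψ ρ
  Sat (φ ∨̇ ψ) ρ = Sat φ ρ ⊎ Sat ψ ρ
  Sat (φ ⇒̇ ψ) ρ = Sat φ ρ → Sat ψ ρ
  Sat (∀̇ φ)   ρ = ∀ x → Sat φ (x ∷ ρ)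
  Sat (∃̇ φ)   ρ = ∃[ x ] Sat φ (x ∷ ρ)

  -- Kripke–Platek set theory, with the full foundation scheme and without
  -- the axiom of infinity.  Each field is the Tarskian reading of an axiom
  -- (scheme); the vector ρ supplies the parameters of a scheme instance.
  -- Pairing and union are in the weak form, sharpened by Δ₀-separation.

  record IsKPModel : Set where
    field
      extensionality : ∀ x y → (∀ z → z ε x ⇔ z ε y) → x ≡ y
      pairing        : ∀ x y → ∃[ a ] (x ε a × y ε a)
      union          : ∀ a → ∃[ b ] (∀ y → y ε a → ∀ x → x ε y → x ε b)
      foundation     : ∀ {n} (φ : Formula (suc n)) (ρ : Vec M n) →
                       (∃[ x ] Sat φ (x ∷ ρ)) →
                       ∃[ x ] (Sat φ (x ∷ ρ) ×
                               (∀ y → y ε x → ¬ Sat φ (y ∷ ρ)))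
      Δ₀-separation  : ∀ {n} (φ : Formula (suc n)) → Δ₀ φ →
                       ∀ (ρ : Vec M n) a →
                       ∃[ b ] (∀ x → x ε b ⇔ (x ε a × Sat φ (x ∷ ρ)))
      Δ₀-collection  : ∀ {n} (φ : Formula (suc (suc n))) → Δ₀ φ →
                       ∀ (ρ : Vec M n) a →
                       (∀ x → x ε a → ∃[ y ] Sat φ (y ∷ x ∷ ρ)) →
                       ∃[ b ] (∀ x → x ε a →
                               ∃[ y ] (y ε b × Sat φ (y ∷ x ∷ ρ)))

  IllFounded : Set
  IllFounded = ¬ WellFounded _ε_

-- Finite or countably infinite.

Countable : Set → Set
Countable A = A ↣ ℕ

Acyclic : {G : Set} → Rel G 0ℓ → Set
Acyclic _⇀_ = ∀ x → ¬ TransClosure _⇀_ x x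

-- ⟨G, ⇀⟩ is isomorphic to the substructure of ⟨M, ε⟩ induced on S.  Elements
-- of Σ M S are compared by their first components only, so that S acts as a
-- subset even when its membership proofs are not unique.  The library's order
-- isomorphisms presuppose no order axioms.

IsomorphicToInduced : {G M : Set} → Rel G 0ℓ → Rel M 0ℓ → Pred M 0ℓ → Set
IsomorphicToInduced {G} {M} _⇀_ _ε_ S =
  Σ[ f ∈ (G → Σ M S) ]
    IsOrderIsomorphism _≡_ (_≡_ on proj₁) _⇀_ (_ε_ on proj₁) f

IsomorphicToSubmodel : {G M : Set} → Rel G 0ℓ → Rel M 0ℓ → Set₁
IsomorphicToSubmodel {G} {M} _⇀_ _ε_ =
  Σ[ S ∈ Pred M 0ℓ ] IsomorphicToInduced _⇀_ _ε_ S

{-# OPTIONS --safe #-}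
module Submission where

-- Write a ≺ b when b contains a and is closed, for arguments in a, under
-- z, y ↦ z ∪ {y} and m ↦ {x ∈ a : m ∈ x}.  Say that an interval a ≺ b carries the
-- clock d if for every e ∈ d some r splits it into a ≺ r ≺ q ⊆ b, both of whose
-- halves carry e.  A set of triples (d , a , q) witnessing all these splittings makes
-- this a first-order property, and ∈-induction inside the model puts every clock on
-- some interval.  With an externally ill-founded clock one can pass to ill-founded
-- clocks forever, so the intervals carrying one form a dense transitive relation ◁.
--
-- An acyclic relation E on ℕ therefore maps into ◁ by some n ↦ U n.  Fixing an antichain
-- of markers mₙ below all U n, the sets
--   f n = {x ∈ U n : mₙ ∈ x} ∪ {mₙ} ∪ {f i : i < n, E i n} ∪ {mᵢ : i < n, E n i}
-- embed E: an edge to a later point is recorded by listing f i in f n, an edge to an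
-- earlier point k by putting the marker mₖ into f n, which lies in U k.

open import Defs
open import Axiom.ExcludedMiddle using (ExcludedMiddle)
open import Level using (0ℓ)
open import Relation.Binary.Core using (Rel)
open import Data.Bool.Base using (if_then_else_)
open import Data.Empty using (⊥-elim)
open import Data.Fin.Base using (Fin; zero; suc)
open import Data.Fin.Patterns
open import Data.List.Base using (List; []; _∷_)
open import Data.List.Membership.Propositional using (_∈_)
open import Data.List.Relation.Unary.All as All using (All; []; _∷_)
open import Data.List.Relation.Unary.AllPairs using (AllPairs; []; _∷_)
open import Data.List.Relation.Unary.Any using (here; there)
open import Data.Nat.Base using (ℕ; zero; suc; _<_; _≤′_; ≤′-refl; ≤′-step; _⊔_; s≤s)
open import Data.Nat.Properties
  using (<-cmp; <-trans; <-irrefl; m<1+n⇒m<n∨m≡n; m<n⇒m<1+n; n<1+n; ≤⇒≤′; m≤m⊔n; m≤n⊔m)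
open import Data.Product.Base using (∃; ∃-syntax; _×_; _,_; proj₁; proj₂; uncurry)
open import Data.Sum.Base using (_⊎_; inj₁; inj₂; [_,_]′)
open import Data.Vec.Base using (Vec; []; _∷_)
open import Function.Base using (_∘_; id)
open import Function.Bundles using (Equivalence; mk⇔; Injection)
open import Induction.WellFounded using (Acc; acc)
open import Relation.Binary.Construct.Closure.Transitive using (TransClosure; [_]; _∷_; _++_)
open import Relation.Binary.Definitions using (tri<; tri≈; tri>)
open import Relation.Binary.PropositionalEquality
  using (_≡_; _≢_; refl; sym; trans; cong; subst)
open import Relation.Nullary using (¬_; does; yes; no; contradiction)
open import Relation.Unary using (Pred)

-- Embeddings of relations, and transfer to the natural numbers.

infix 4 _↪_

_↪_ : {A B : Set} → Rel A 0ℓ → Rel B 0ℓ → Set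
_↪_ {A} {B} R S = ∃ λ (f : A → B) →
  (∀ x y → f x ≡ f y → x ≡ y) ×
  (∀ x y → R x y → S (f x) (f y)) ×
  (∀ x y → S (f x) (f y) → R x y)

↪-trans : {A B C : Set} {R : Rel A 0ℓ} {S : Rel B 0ℓ} {T : Rel C 0ℓ} →
          R ↪ S → S ↪ T → R ↪ T
↪-trans (f , f-inj , f-mono , f-cancel) (g , g-inj , g-mono , g-cancel) =
  g ∘ f ,
  (λ x y → f-inj x y ∘ g-inj (f x) (f y)) ,
  (λ x y → g-mono (f x) (f y) ∘ f-mono x y) ,
  (λ x y → f-cancel x y ∘ g-cancel (f x) (f y))

↪⇒submodel : {A B : Set} {R : Rel A 0ℓ} {S : Rel B 0ℓ} →
             R ↪ S → IsomorphicToSubmodel R S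
↪⇒submodel (f , injective , mono , cancel) =
  (λ b → ∃[ a ] b ≡ f a) , (λ a → f a , a , refl) , record
    { isOrderMonomorphism = record
      { isOrderHomomorphism = record { cong = cong f ; mono = mono _ _ }
      ; injective = injective _ _
      ; cancel    = cancel _ _ }
    ; surjective = λ { (_ , a , b≡fa) → a , λ { refl → sym b≡fa } } }

-- Injectivity of `index` glues consecutive edges of an `E`-path back together in `G`, so a cycle of
-- `E` would yield a cycle of `_⇀_`.
countable-acyclic : {G : Set} {_⇀_ : Rel G 0ℓ} → Countable G → Acyclic _⇀_ →
                    ∃ λ (E : Rel ℕ 0ℓ) → Acyclic E × _⇀_ ↪ E
countable-acyclic {G} {_⇀_} count acyclic =
  E , E-acyclic ,
  index , (λ _ _ → injective) , (λ x y e → x , y , refl , refl , e) , cancel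
  where
  open Injection count using (injective) renaming (to to index)

  E : Rel ℕ 0ℓ
  E i j = ∃[ x ] ∃[ y ] (index x ≡ i × index y ≡ j × x ⇀ y)

  pull : ∀ {i j} → TransClosure E i j →
         ∃[ x ] ∃[ y ] (index x ≡ i × index y ≡ j × TransClosure _⇀_ x y)
  pull [ x , y , p , q , e ] = x , y , p , q , [ e ]
  pull ((x , y , p , q , e) ∷ es) with pull es
  ... | y′ , z , p′ , q′ , es′ with injective (trans q (sym p′))
  ... | refl = x , z , p , q′ , e ∷ es′

  E-acyclic : Acyclic E
  E-acyclic i c with pull c
  ... | x , y , p , q , es with injective (trans p (sym q))
  ... | refl = acyclic x es

  cancel : ∀ x y → E (index x) (index y) → x ⇀ y
  cancel x y (x′ , y′ , p , q , e) with injective p | injective q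
  ... | refl | refl = e

-- Classical descent along ill-founded points.

module _ (em : ExcludedMiddle 0ℓ) where

  ¬∀⇒∃¬ : {A : Set} {P : Pred A 0ℓ} → ¬ (∀ x → P x) → ∃[ x ] ¬ P x
  ¬∀⇒∃¬ {P = P} ¬all with em {∃[ x ] ¬ P x}
  ... | yes ex = ex
  ... | no ¬ex = contradiction all ¬all
    where
    all : ∀ x → P x
    all x with em {P x}
    ... | yes p = p
    ... | no ¬p = contradiction (x , ¬p) ¬ex

  ¬Acc-descends : {A : Set} {_R_ : Rel A 0ℓ} {x : A} →
                  ¬ Acc _R_ x → ∃[ y ] (y R x × ¬ Acc _R_ y)
  ¬Acc-descends {_R_ = _R_} {x} ¬acc with em {∃[ y ] (y R x × ¬ Acc _R_ y)}
  ... | yes ex = ex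
  ... | no ¬ex = contradiction (acc below) ¬acc
    where
    below : ∀ {y} → y R x → Acc _R_ y
    below {y} yRx with em {Acc _R_ y}
    ... | yes a = a
    ... | no ¬a = contradiction (y , yRx , ¬a) ¬ex

-- Mapping an acyclic relation into a dense transitive one.

module DenseOrder
  (em : ExcludedMiddle 0ℓ) {X : Set} (_≺_ : Rel X 0ℓ)
  (≺-trans : ∀ {u v w} → u ≺ v → v ≺ w → u ≺ w)
  (≺-dense : ∀ {u v} → u ≺ v → ∃[ r ] (u ≺ r × r ≺ v))
  {⊥ᵒ ⊤ᵒ : X} (⊥≺⊤ : ⊥ᵒ ≺ ⊤ᵒ)
  (E : Rel ℕ 0ℓ) (acyclic : Acyclic E)
  where

  _⊏_ : Rel ℕ 0ℓ
  _⊏_ = TransClosure E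

  Between : X → Pred (ℕ × X) 0ℓ
  Between lo (_ , v) = lo ≺ v × v ≺ ⊤ᵒ

  Before : Rel (ℕ × X) 0ℓ
  Before (i , u) (j , v) = u ≺ v × ¬ (j ⊏ i)

  -- The field `all` confines `result` to the new point and the old ones, in the form that carries
  -- both bounds and order conditions over to the longer list.
  record Insertion (n : ℕ) (lo : X) (xs : List (ℕ × X)) : Set₁ where
    field
      value   : X
      result  : List (ℕ × X)
      between : Between lo (n , value)
      all     : {P : Pred (ℕ × X) 0ℓ} → P (n , value) → All P xs → All P result
      chain   : AllPairs Before result
      new     : (n , value) ∈ result
      old     : ∀ {p} → p ∈ xs → p ∈ result

  -- The new point goes right after the last point that must precede it;
  -- a point that must follow it cannot stand earlier, as ⊏ is transitive.
  insert : ∀ n {lo} xs → lo ≺ ⊤ᵒ → All (Between lo) xs → AllPairs Before xs →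
           Insertion n lo xs
  insert n [] lo≺⊤ [] [] with ≺-dense lo≺⊤
  ... | u , lo≺u , u≺⊤ = record
    { value = u ; result = (n , u) ∷ [] ; between = lo≺u , u≺⊤
    ; all = λ p ps → p ∷ ps ; chain = [] ∷ [] ; new = here refl ; old = there }
  insert n ((i , v) ∷ xs) lo≺⊤ ((lo≺v , v≺⊤) ∷ bs) (v<xs ∷ ch)
    with em {∃[ p ] (p ∈ (i , v) ∷ xs × proj₁ p ⊏ n)}
  ... | yes (p , p∈ , p⊏n) = record
    { value = value ; result = (i , v) ∷ result
    ; between = ≺-trans lo≺v (proj₁ between) , proj₂ between
    ; all = λ { q (r ∷ rs) → r ∷ all q rs }
    ; chain = all (proj₁ between , n⊏̸i p∈) v<xs ∷ chain
    ; new = there new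
    ; old = λ { (here p≡) → here p≡ ; (there q) → there (old q) } }
    where
    insertion-above : Insertion n v xs
    insertion-above = insert n xs v≺⊤
      (All.zipWith (λ ((v≺w , _) , (_ , w≺⊤)) → v≺w , w≺⊤) (v<xs , bs)) ch
    open Insertion insertion-above
    n⊏̸i : p ∈ (i , v) ∷ xs → ¬ (n ⊏ i)
    n⊏̸i (here refl) n⊏i = acyclic n (n⊏i ++ p⊏n)
    n⊏̸i (there q)   n⊏i = proj₂ (All.lookup v<xs q) (p⊏n ++ n⊏i)
  ... | no none with ≺-dense lo≺v
  ... | u , lo≺u , u≺v = record
    { value = u ; result = (n , u) ∷ (i , v) ∷ xs
    ; between = lo≺u , ≺-trans u≺v v≺⊤
    ; all = λ p ps → p ∷ ps
    ; chain = All.tabulate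
        (λ { {p} p∈ → u≺ p∈ , λ p⊏n → none (p , p∈ , p⊏n) }) ∷ v<xs ∷ ch
    ; new = here refl ; old = there }
    where
    u≺ : ∀ {p} → p ∈ (i , v) ∷ xs → u ≺ proj₂ p
    u≺ (here refl) = u≺v
    u≺ (there q)   = ≺-trans u≺v (proj₁ (All.lookup v<xs q))

  Chain : Set
  Chain = ∃[ xs ] (All (Between ⊥ᵒ) xs × AllPairs Before xs)

  stage : ℕ → Chain
  insertion : ∀ n → Insertion n ⊥ᵒ (proj₁ (stage n))

  stage zero    = [] , [] , []
  stage (suc n) = result , all between (proj₁ (proj₂ (stage n))) , chain
    where open Insertion (insertion n)
  insertion n = insert n (proj₁ s) ⊥≺⊤ (proj₁ (proj₂ s)) (proj₂ (proj₂ s))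
    where s = stage n

  embed : ℕ → X
  embed n = Insertion.value (insertion n)

  ⊥≺embed : ∀ n → ⊥ᵒ ≺ embed n
  ⊥≺embed n = proj₁ (Insertion.between (insertion n))

  stage-mono : ∀ {m n p} → m ≤′ n → p ∈ proj₁ (stage m) → p ∈ proj₁ (stage n)
  stage-mono ≤′-refl p∈ = p∈
  stage-mono {n = suc n} (≤′-step m≤n) p∈ = Insertion.old (insertion n) (stage-mono m≤n p∈)

  comparable : ∀ {xs p q} → AllPairs Before xs → p ∈ xs → q ∈ xs →
               p ≡ q ⊎ Before p q ⊎ Before q p
  comparable (_ ∷ _) (here refl) (here refl) = inj₁ refl
  comparable (b ∷ _) (here refl) (there q∈)  = inj₂ (inj₁ (All.lookup b q∈))
  comparable (b ∷ _) (there p∈)  (here refl) = inj₂ (inj₂ (All.lookup b p∈))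
  comparable (_ ∷ c) (there p∈)  (there q∈)  = comparable c p∈ q∈

  -- Stage `suc (i ⊔ j)` is the first to list both points. If `j` stood before `i` in it, the second
  -- half of `Before` would exclude the edge.
  embed-mono : ∀ {i j} → E i j → embed i ≺ embed j
  embed-mono {i} {j} e
    with comparable (proj₂ (proj₂ (stage (suc (i ⊔ j)))))
           (stage-mono (≤⇒≤′ (s≤s (m≤m⊔n i j))) (Insertion.new (insertion i)))
           (stage-mono (≤⇒≤′ (s≤s (m≤n⊔m i j))) (Insertion.new (insertion j)))
  ... | inj₁ p≡               = ⊥-elim (acyclic j [ subst (λ k → E k j) (cong proj₁ p≡) e ])
  ... | inj₂ (inj₁ (i≺j , _)) = i≺j
  ... | inj₂ (inj₂ (_ , i⊏̸j)) = contradiction [ e ] i⊏̸j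

-- Bounded formulas for the set-theoretic notions.

module Formulas where

  -- Exactly the shapes accepted by `ball` and `bex`. `Sat` unfolds the formulas built from them
  -- definitionally to the corresponding predicates of `KP`.
  ∀∈ ∃∈ : ∀ {n} → Fin n → Formula (suc n) → Formula n
  ∀∈ t φ = ∀̇ (zero ∈̇ suc t ⇒̇ φ)
  ∃∈ t φ = ∃̇ (zero ∈̇ suc t ∧̇ φ)

  subset : ∀ {n} (a b : Fin n) → Formula n
  subset a b = ∀∈ a (zero ∈̇ suc b)

  transitive : ∀ {n} (a : Fin n) → Formula n
  transitive a = ∀∈ a (∀∈ zero (zero ∈̇ suc (suc a)))

  adjunction : ∀ {n} (b z y : Fin n) → Formula n
  adjunction b z y =
    ∀∈ b (zero ∈̇ suc z ∨̇ zero ≐ suc y) ∧̇ subset z b ∧̇ y ∈̇ b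

  selection : ∀ {n} (b a m : Fin n) → Formula n
  selection b a m =
    ∀∈ b (zero ∈̇ suc a ∧̇ suc m ∈̇ zero) ∧̇
    ∀∈ a (suc m ∈̇ zero ⇒̇ zero ∈̇ suc b)

  extends : ∀ {n} (a b : Fin n) → Formula n
  extends a b =
    subset a b ∧̇
    ∀∈ a (∀∈ (suc a) (∃∈ (suc (suc b)) (adjunction 0F 2F 1F))) ∧̇
    ∀∈ a (∃∈ (suc b) (selection 0F (suc (suc a)) 1F))

  code : ∀ {n} (t d p q : Fin n) → Formula n
  code t d p q = d ∈̇ t ∧̇ p ∈̇ t ∧̇ q ∈̇ t ∧̇ d ∈̇ p ∧̇ p ∈̇ q

  splits : ∀ {n} (w e p q : Fin n) → Formula n
  splits {n} w e p q =
    ∃∈ w (∃∈ (suc w) (∃∈ 1F (∃∈ 1F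
      (code 3F (4+ e) (4+ p) 1F ∧̇ code 2F (4+ e) 1F 0F ∧̇ subset 0F (4+ q)))))
    where
    4+_ : Fin n → Fin (suc (suc (suc (suc n))))
    4+ i = suc (suc (suc (suc i)))

  good : ∀ {n} (w : Fin n) → Formula n
  good w =
    ∀∈ w (∀∈ 0F (∀∈ 1F (∀∈ 2F
      (code 3F 2F 1F 0F ⇒̇
        extends 1F 0F ∧̇
        ∀∈ 2F (splits (suc (suc (suc (suc (suc w))))) 0F 2F 1F)))))

  transitive-Δ₀ : ∀ {n} (a : Fin n) → Δ₀ (transitive a)
  transitive-Δ₀ a = ball _ (ball _ (mem _ _))

  adjunction-Δ₀ : ∀ {n} (b z y : Fin n) → Δ₀ (adjunction b z y)
  adjunction-Δ₀ b z y =
    and (ball _ (or (mem _ _) (eq _ _))) (and (ball _ (mem _ _)) (mem _ _))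

  selection-Δ₀ : ∀ {n} (b a m : Fin n) → Δ₀ (selection b a m)
  selection-Δ₀ b a m =
    and (ball _ (and (mem _ _) (mem _ _))) (ball _ (imp (mem _ _) (mem _ _)))

  code-Δ₀ : ∀ {n} (t d p q : Fin n) → Δ₀ (code t d p q)
  code-Δ₀ t d p q =
    and (mem _ _) (and (mem _ _) (and (mem _ _) (and (mem _ _) (mem _ _))))

  splits-Δ₀ : ∀ {n} (w e p q : Fin n) → Δ₀ (splits w e p q)
  splits-Δ₀ w e p q =
    bex _ (bex _ (bex _ (bex _
      (and (code-Δ₀ _ _ _ _) (and (code-Δ₀ _ _ _ _) (ball _ (mem _ _)))))))

  extends-Δ₀ : ∀ {n} (a b : Fin n) → Δ₀ (extends a b)
  extends-Δ₀ a b =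
    and (ball _ (mem _ _))
      (and (ball _ (ball _ (bex _ (adjunction-Δ₀ _ _ _))))
           (ball _ (bex _ (selection-Δ₀ _ _ _))))

  good-Δ₀ : ∀ {n} (w : Fin n) → Δ₀ (good w)
  good-Δ₀ w =
    ball _ (ball _ (ball _ (ball _
      (imp (code-Δ₀ _ _ _ _)
        (and (extends-Δ₀ _ _) (ball _ (splits-Δ₀ _ _ _ _)))))))

-- Induction and absence of short membership cycles in a KP model.

module KP
  (em : ExcludedMiddle 0ℓ) {M : Set} (_ε_ : Rel M 0ℓ) (kp : IsKPModel _ε_)
  where

  open IsKPModel kp
  open Formulas

  induction : ∀ {n} (φ : Formula (suc n)) (ρ : Vec M n) →
              (∀ x → (∀ y → y ε x → Sat _ε_ φ (y ∷ ρ)) → Sat _ε_ φ (x ∷ ρ)) →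
              ∀ x → Sat _ε_ φ (x ∷ ρ)
  induction φ ρ step x with em {Sat _ε_ φ (x ∷ ρ)}
  ... | yes s = s
  ... | no ¬s with foundation (φ ⇒̇ ⊥̇) ρ (x , ¬s)
  ... | y , ¬sy , min = contradiction (step y below) ¬sy
    where
    below : ∀ z → z ε y → Sat _ε_ φ (z ∷ ρ)
    below z z∈y with em {Sat _ε_ φ (z ∷ ρ)}
    ... | yes s = s
    ... | no ¬sz = contradiction ¬sz (min z z∈y)

  ε-irrefl : ∀ {x} → ¬ (x ε x)
  ε-irrefl {x} x∈x with foundation (0F ∈̇ 0F) [] (x , x∈x)
  ... | y , y∈y , min = min y y∈y y∈y

  ε-asym : ∀ {x y} → x ε y → ¬ (y ε x)
  ε-asym {x} {y} x∈y y∈x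
    with foundation (∃̇ (1F ∈̇ 0F ∧̇ 0F ∈̇ 1F)) [] (x , y , x∈y , y∈x)
  ... | u , (v , u∈v , v∈u) , min = min v v∈u (u , v∈u , u∈v)

  ε-no-3-cycle : ∀ {x y z} → x ε y → y ε z → ¬ (z ε x)
  ε-no-3-cycle {x} {y} {z} x∈y y∈z z∈x
    with foundation (∃̇ (∃̇ (2F ∈̇ 1F ∧̇ 1F ∈̇ 0F ∧̇ 0F ∈̇ 2F))) []
           (x , y , z , x∈y , y∈z , z∈x)
  ... | u , (v , w , u∈v , v∈w , w∈u) , min = min w w∈u (u , v , w∈u , u∈v , v∈w)

  _⊆_ : Rel M 0ℓ
  a ⊆ b = ∀ x → x ε a → x ε b

  ⊆-trans : ∀ {a b c} → a ⊆ b → b ⊆ c → a ⊆ c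
  ⊆-trans f g x = g x ∘ f x

  Transitive : Pred M 0ℓ
  Transitive a = ∀ y → y ε a → ∀ z → z ε y → z ε a

  Adjunction : M → M → M → Set
  Adjunction b z y = (∀ x → x ε b → x ε z ⊎ x ≡ y) × z ⊆ b × y ε b

  Selection : M → M → M → Set
  Selection b a m = (∀ x → x ε b → x ε a × m ε x) × (∀ x → x ε a → m ε x → x ε b)

  Extends : Rel M 0ℓ
  Extends a b =
    a ⊆ b ×
    (∀ z → z ε a → ∀ y → y ε a → ∃[ c ] (c ε b × Adjunction c z y)) ×
    (∀ m → m ε a → ∃[ c ] (c ε b × Selection c a m))

  -- The set {d, p, q} codes the triple (d, p, q) with d ε p ε q.
  Code : M → M → M → M → Set
  Code t d p q = d ε t × p ε t × q ε t × d ε p × p ε q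

  -- Bounding `r` and `q′` by the codes `s` and `t` keeps this Δ₀. Ending at some `q′ ⊆ q` lets a
  -- splitting survive an enlargement of `q`.
  Splits : M → M → M → M → Set
  Splits w e p q =
    ∃[ s ] (s ε w × ∃[ t ] (t ε w × ∃[ r ] (r ε s × ∃[ q′ ] (q′ ε t ×
      Code s e p r × Code t e r q′ × q′ ⊆ q))))

  -- A self-supporting certificate: the halves demanded by a triple in `w` are coded in `w` again,
  -- which replaces a recursion on clocks.
  Good : Pred M 0ℓ
  Good w =
    ∀ t → t ε w → ∀ d → d ε t → ∀ p → p ε t → ∀ q → q ε t → Code t d p q →
    Extends p q × (∀ e → e ε d → Splits w e p q)

  Gap : M → M → M → M → Set
  Gap w d p q = ∃[ t ] (t ε w × Code t d p q)

  -- Basic set constructions.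

  ∪-bound : ∀ a b → ∃[ c ] (a ⊆ c × b ⊆ c)
  ∪-bound a b with pairing a b
  ... | p , a∈p , b∈p with union p
  ... | c , ⋃p⊆c = c , ⋃p⊆c a a∈p , ⋃p⊆c b b∈p

  adjoin : ∀ z y → ∃[ b ] Adjunction b z y
  adjoin z y with pairing y y
  ... | s , y∈s , _ with ∪-bound z s
  ... | u , z⊆u , s⊆u
    with Δ₀-separation (0F ∈̇ 1F ∨̇ 0F ≐ 2F) (or (mem _ _) (eq _ _)) (z ∷ y ∷ []) u
  ... | b , b-spec =
    b , (λ x x∈b → proj₂ (Equivalence.to (b-spec x) x∈b))
      , (λ x x∈z → Equivalence.from (b-spec x) (z⊆u x x∈z , inj₁ x∈z))
      , Equivalence.from (b-spec y) (s⊆u y y∈s , inj₂ refl)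

  select : ∀ a m → ∃[ b ] Selection b a m
  select a m with Δ₀-separation (1F ∈̇ 0F) (mem _ _) (m ∷ []) a
  ... | b , b-spec =
    b , (λ x → Equivalence.to (b-spec x))
      , (λ x x∈a m∈x → Equivalence.from (b-spec x) (x∈a , m∈x))

  adjunction-unique : ∀ {b c z y} → Adjunction b z y → Adjunction c z y → b ≡ c
  adjunction-unique (f , z⊆b , y∈b) (g , z⊆c , y∈c) = extensionality _ _ λ x →
    mk⇔ (λ x∈b → [ z⊆c x , (λ { refl → y∈c }) ]′ (f x x∈b))
        (λ x∈c → [ z⊆b x , (λ { refl → y∈b }) ]′ (g x x∈c))

  selection-unique : ∀ {b c a m} → Selection b a m → Selection c a m → b ≡ c
  selection-unique (f , g) (f′ , g′) = extensionality _ _ λ x →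
    mk⇔ (uncurry (g′ x) ∘ f x) (uncurry (g x) ∘ f′ x)

  extends-⊆ : ∀ {a b c} → Extends a b → b ⊆ c → Extends a c
  extends-⊆ (a⊆b , adj , sel) b⊆c =
    ⊆-trans a⊆b b⊆c ,
    (λ z z∈a y y∈a → let (s , s∈b , p) = adj z z∈a y y∈a in s , b⊆c s s∈b , p) ,
    (λ m m∈a → let (s , s∈b , p) = sel m m∈a in s , b⊆c s s∈b , p)

  -- The adjunctions are gathered by nested collection: for each `z` one set bounds those with `y`
  -- in `a`, a second collection bounds these sets, and a union flattens the result.
  extension : ∀ a → ∃[ b ] Extends a b
  extension a
    with Δ₀-collection (selection 0F 2F 1F) (selection-Δ₀ _ _ _) (a ∷ []) a
           (λ m _ → select a m)
       | Δ₀-collection (∀∈ 2F (∃∈ 1F (adjunction 0F 3F 1F)))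
           (ball _ (bex _ (adjunction-Δ₀ _ _ _))) (a ∷ []) a
           (λ z _ → Δ₀-collection (adjunction 0F 2F 1F) (adjunction-Δ₀ _ _ _)
                      (z ∷ []) a (λ y _ → adjoin z y))
  ... | s , sels | r , adjs with union r
  ... | u , ⋃r⊆u with ∪-bound a s
  ... | v , a⊆v , s⊆v with ∪-bound u v
  ... | b , u⊆b , v⊆b =
    b , ⊆-trans a⊆v v⊆b
      , (λ z z∈a y y∈a →
          let (k , k∈r , all) = adjs z z∈a ; (c , c∈k , p) = all y y∈a
          in c , u⊆b c (⋃r⊆u k k∈r c c∈k) , p)
      , (λ m m∈a → let (c , c∈s , p) = sels m m∈a in c , v⊆b c (s⊆v c c∈s) , p)

  -- The set `b` collected in the induction step may have members that are not transitive, so `s` is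
  -- the union of its transitive members only. It includes `x`, hence stays transitive when `x` is
  -- adjoined.
  transitive-superset : ∀ x → ∃[ t ] (x ε t × Transitive t)
  transitive-superset = induction (∃̇ (1F ∈̇ 0F ∧̇ transitive 0F)) [] step
    where
    step : ∀ x → (∀ y → y ε x → ∃[ t ] (y ε t × Transitive t)) →
           ∃[ t ] (x ε t × Transitive t)
    step x ih
      with Δ₀-collection (1F ∈̇ 0F ∧̇ transitive 0F) (and (mem _ _) (transitive-Δ₀ _))
             [] x ih
    ... | b , col with union b
    ... | u , ⋃b⊆u
      with Δ₀-separation (∃∈ 1F (transitive 0F ∧̇ 1F ∈̇ 0F))
             (bex _ (and (transitive-Δ₀ _) (mem _ _))) (b ∷ []) u
    ... | s , s-spec with adjoin s x
    ... | t , t⊆ , s⊆t , x∈t = t , x∈t , tr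
      where
      x⊆s : x ⊆ s
      x⊆s y y∈x with col y y∈x
      ... | k , k∈b , y∈k , tk =
        Equivalence.from (s-spec y) (⋃b⊆u k k∈b y y∈k , k , k∈b , tk , y∈k)
      s-transitive : Transitive s
      s-transitive y y∈s z z∈y with Equivalence.to (s-spec y) y∈s
      ... | _ , k , k∈b , tk , y∈k =
        let z∈k = tk y y∈k z z∈y
        in Equivalence.from (s-spec z) (⋃b⊆u k k∈b z z∈k , k , k∈b , tk , z∈k)
      tr : Transitive t
      tr y y∈t z z∈y with t⊆ y y∈t
      ... | inj₁ y∈s  = s⊆t z (s-transitive y y∈s z z∈y)
      ... | inj₂ refl = s⊆t z (x⊆s z z∈y)

  -- Good sets and the existence of gaps.

  splits-mono : ∀ {w w′ e p q q′} → w ⊆ w′ → q ⊆ q′ → Splits w e p q → Splits w′ e p q′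
  splits-mono w⊆w′ q⊆q′ (s , s∈w , t , t∈w , r , r∈s , k , k∈t , cs , ct , k⊆q) =
    s , w⊆w′ s s∈w , t , w⊆w′ t t∈w , r , r∈s , k , k∈t , cs , ct , ⊆-trans k⊆q q⊆q′

  -- Enlarging `w` preserves `Splits`, so a union of good sets is good. As goodness is Δ₀,
  -- separation can form the union of just the good members of `u`.
  merge : ∀ u → ∃[ v ] (Good v × (∀ w → w ε u → Good w → w ⊆ v))
  merge u with union u
  ... | k , ⋃u⊆k
    with Δ₀-separation (∃∈ 1F (good 0F ∧̇ 1F ∈̇ 0F)) (bex _ (and (good-Δ₀ _) (mem _ _)))
           (u ∷ []) k
  ... | v , v-spec = v , v-good , sub
    where
    sub : ∀ w → w ε u → Good w → w ⊆ v
    sub w w∈u gw t t∈w =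
      Equivalence.from (v-spec t) (⋃u⊆k w w∈u t t∈w , w , w∈u , gw , t∈w)
    v-good : Good v
    v-good t t∈v d d∈t p p∈t q q∈t c with Equivalence.to (v-spec t) t∈v
    ... | _ , w , w∈u , gw , t∈w with gw t t∈w d d∈t p p∈t q q∈t c
    ... | ext , spl = ext , λ e e∈d →
      splits-mono (sub w w∈u gw) (λ _ → id) (spl e e∈d)

  -- Without membership cycles of length up to three, the elements of {d, p, q} form a chain of two
  -- membership steps in only one way, so the unordered set determines the triple.
  triple : ∀ d p q → d ε p → p ε q →
           ∃[ t ] (Code t d p q ×
                   (∀ {d′ p′ q′} → Code t d′ p′ q′ → d′ ≡ d × p′ ≡ p × q′ ≡ q))
  -- An element of `o` would be both in `d` and above it, so `o` is empty.
  triple d p q d∈p p∈q with select d d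
  ... | o , o⊆ , _ with adjoin o d
  ... | a , a⊆ , _ , d∈a with adjoin a p
  ... | b , b⊆ , a⊆b , p∈b with adjoin b q
  ... | t , t⊆ , b⊆t , q∈t =
    t , (b⊆t d (a⊆b d d∈a) , b⊆t p p∈b , q∈t , d∈p , p∈q) , unique
    where
    data Member : Pred M 0ℓ where
      is-d : Member d
      is-p : Member p
      is-q : Member q
    members : ∀ x → x ε t → Member x
    members x x∈t with t⊆ x x∈t
    ... | inj₂ refl = is-q
    ... | inj₁ x∈b with b⊆ x x∈b
    ... | inj₂ refl = is-p
    ... | inj₁ x∈a with a⊆ x x∈a
    ... | inj₂ refl = is-d
    ... | inj₁ x∈o = ⊥-elim (uncurry ε-asym (o⊆ x x∈o))
    ordered : ∀ {x y z} → Member x → Member y → Member z → x ε y → y ε z →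
              x ≡ d × y ≡ p × z ≡ q
    ordered is-d is-d _ h _ = ⊥-elim (ε-irrefl h)
    ordered is-p is-d _ h _ = ⊥-elim (ε-asym h d∈p)
    ordered is-q is-d _ h _ = ⊥-elim (ε-no-3-cycle d∈p p∈q h)
    ordered _ is-q is-d _ h = ⊥-elim (ε-no-3-cycle d∈p p∈q h)
    ordered _ is-q is-p _ h = ⊥-elim (ε-asym h p∈q)
    ordered _ is-q is-q _ h = ⊥-elim (ε-irrefl h)
    ordered _ is-p is-d _ h = ⊥-elim (ε-asym h d∈p)
    ordered _ is-p is-p _ h = ⊥-elim (ε-irrefl h)
    ordered is-p is-p is-q h _ = ⊥-elim (ε-irrefl h)
    ordered is-q is-p is-q h _ = ⊥-elim (ε-asym h p∈q)
    ordered is-d is-p is-q _ _ = refl , refl , refl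
    unique : ∀ {d′ p′ q′} → Code t d′ p′ q′ → d′ ≡ d × p′ ≡ p × q′ ≡ q
    unique (d∈t , p∈t , r∈t , h , k) =
      ordered (members _ d∈t) (members _ p∈t) (members _ r∈t) h k

  -- The induction on `c` treats all left ends `a` at once because a right half starts at a new
  -- point. With `T` transitive, `T ⊆ a` puts every smaller clock into the left end, as `Code`
  -- demands.
  gap-exists : ∀ {T} → Transitive T → ∀ c → c ε T → ∀ a → T ⊆ a →
               ∃[ b ] ∃[ w ] (Good w × Gap w c a b)
  gap-exists {T} T-trans = induction
    (0F ∈̇ 1F ⇒̇ ∀̇ (subset 2F 0F ⇒̇
      ∃̇ (∃̇ (good 0F ∧̇ ∃∈ 0F (code 0F 4F 3F 2F)))))
    (T ∷ []) step
    where
    Claim : Pred M 0ℓ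
    Claim c = c ε T → ∀ a → T ⊆ a → ∃[ b ] ∃[ w ] (Good w × Gap w c a b)

    -- The hypothesis for `e` is used twice, from `a` to `r` and from `r` to `q`. Packing `w` and
    -- `q` into one set `y` makes the statement to be collected Δ₀.
    half : ∀ {e} → Claim e → e ε T → ∀ a → T ⊆ a →
           ∃[ y ] ∃[ w ] (w ε y × ∃[ q ] (q ε y × Good w × Splits w e a q))
    half ih e∈T a T⊆a with ih e∈T a T⊆a
    ... | r , w₁ , g₁ , s , s∈w₁ , cs@(e∈s , a∈s , r∈s , _)
      with g₁ s s∈w₁ _ e∈s _ a∈s _ r∈s cs
    ... | (a⊆r , _) , _ with ih e∈T r (⊆-trans T⊆a a⊆r)
    ... | q , w₂ , g₂ , t , t∈w₂ , ct@(_ , _ , q∈t , _) with pairing w₁ w₂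
    ... | u , w₁∈u , w₂∈u with merge u
    ... | w , gw , sub with pairing w q
    ... | y , w∈y , q∈y =
      y , w , w∈y , q , q∈y , gw ,
      s , sub w₁ w₁∈u g₁ s s∈w₁ , t , sub w₂ w₂∈u g₂ t t∈w₂ ,
      r , r∈s , q , q∈t , cs , ct , λ _ → id

    step : ∀ c → (∀ e → e ε c → Claim e) → Claim c
    step c ih c∈T a T⊆a
      with Δ₀-collection (∃∈ 0F (∃∈ 1F (good 1F ∧̇ splits 1F 3F 4F 0F)))
             (bex _ (bex _ (and (good-Δ₀ _) (splits-Δ₀ _ _ _ _)))) (a ∷ []) c
             (λ e e∈c → half (ih e e∈c) (T-trans c c∈T e e∈c) a T⊆a)
    ... | k , col with union k
    ... | u , ⋃k⊆u with merge u | union u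
    -- The right end `b` must extend `a` (by `b₀`), contain it (by `s`) and include all collected
    -- right ends (by `r`).
    ... | v , gv , sub | r , ⋃u⊆r with extension a | pairing a a
    ... | b₀ , ext | s , a∈s , _ with ∪-bound r s
    ... | b₁ , r⊆b₁ , s⊆b₁ with ∪-bound b₀ b₁
    ... | b , b₀⊆b , b₁⊆b with triple c a b (T⊆a c c∈T) (b₁⊆b a (s⊆b₁ a a∈s))
    ... | t , ct , unique with adjoin v t
    ... | w , w⊆ , v⊆w , t∈w = b , w , gw , t , t∈w , ct
      where
      c-splits : ∀ e → e ε c → Splits w e a b
      c-splits e e∈c with col e e∈c
      ... | y , y∈k , w′ , w′∈y , q , q∈y , gw′ , spl =
        splits-mono (⊆-trans (sub w′ (⋃k⊆u y y∈k w′ w′∈y) gw′) v⊆w)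
          (λ x x∈q → b₁⊆b x (r⊆b₁ x (⋃u⊆r q (⋃k⊆u y y∈k q q∈y) x x∈q))) spl
      gw : Good w
      gw t′ t′∈w d d∈t p p∈t q q∈t cd with w⊆ t′ t′∈w
      ... | inj₁ t′∈v with gv t′ t′∈v d d∈t p p∈t q q∈t cd
      ... | e , spl = e , λ x x∈d → splits-mono v⊆w (λ _ → id) (spl x x∈d)
      gw t′ t′∈w d d∈t p p∈t q q∈t cd | inj₂ refl with unique cd
      ... | refl , refl , refl = extends-⊆ ext b₀⊆b , c-splits

  -- Chosen adjunctions and selections.

  adj sel : M → M → M
  adj z y = proj₁ (adjoin z y)
  sel a m = proj₁ (select a m)

  ∈adj⁻ : ∀ {x z y} → x ε adj z y → x ε z ⊎ x ≡ y
  ∈adj⁻ {x} {z} {y} = proj₁ (proj₂ (adjoin z y)) x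

  ∈adjˡ : ∀ {x z y} → x ε z → x ε adj z y
  ∈adjˡ {x} {z} {y} = proj₁ (proj₂ (proj₂ (adjoin z y))) x

  ∈adjʳ : ∀ {z y} → y ε adj z y
  ∈adjʳ {z} {y} = proj₂ (proj₂ (proj₂ (adjoin z y)))

  -- The dense relation given by ill-founded clocks, and its markers.

  module IllFoundedGaps {w : M} (w-good : Good w) where

    -- Allowing any superset of `q` as upper end makes transitivity a mere weakening of the first
    -- gap.
    _◁_ : Rel M 0ℓ
    a ◁ b = ∃[ d ] ∃[ q ] (¬ Acc _ε_ d × Gap w d a q × q ⊆ b)

    ◁-extends : ∀ {a b} → a ◁ b → Extends a b
    ◁-extends (d , q , _ , (t , t∈w , c@(d∈t , a∈t , q∈t , _)) , q⊆b) =
      extends-⊆ (proj₁ (w-good t t∈w d d∈t _ a∈t q q∈t c)) q⊆b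

    ◁⇒⊆ : ∀ {a b} → a ◁ b → a ⊆ b
    ◁⇒⊆ = proj₁ ∘ ◁-extends

    ◁⇒ε : ∀ {a b} → a ◁ b → a ε b
    ◁⇒ε (_ , _ , _ , (_ , _ , _ , _ , _ , _ , a∈q) , q⊆b) = q⊆b _ a∈q

    ◁-trans : ∀ {a b c} → a ◁ b → b ◁ c → a ◁ c
    ◁-trans (d , q , ill , gap , q⊆b) b◁c = d , q , ill , gap , ⊆-trans q⊆b (◁⇒⊆ b◁c)

    -- An ill-founded clock has an ill-founded element, and splitting at that element gives it to
    -- both halves.
    ◁-dense : ∀ {a b} → a ◁ b → ∃[ r ] (a ◁ r × r ◁ b)
    ◁-dense (d , q , ill , (t , t∈w , c@(d∈t , a∈t , q∈t , _)) , q⊆b)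
      with ¬Acc-descends em ill
    ... | e , e∈d , ill′ with proj₂ (w-good t t∈w d d∈t _ a∈t q q∈t c) e e∈d
    ... | s , s∈w , t′ , t′∈w , r , _ , q′ , _ , cs , ct , q′⊆q =
      r , (e , r , ill′ , (s , s∈w , cs) , λ _ → id)
        , (e , q′ , ill′ , (t′ , t′∈w , ct) , ⊆-trans q′⊆q q⊆b)

    adj-ε : ∀ {a b z y} → a ◁ b → z ε a → y ε a → adj z y ε b
    adj-ε {b = b} {z} {y} a◁b z∈a y∈a with proj₁ (proj₂ (◁-extends a◁b)) z z∈a y y∈a
    ... | c , c∈b , p = subst (_ε b) (adjunction-unique p (proj₂ (adjoin z y))) c∈b

    sel-ε : ∀ {a b m} → a ◁ b → m ε a → sel a m ε b
    sel-ε {a} {b} {m} a◁b m∈a with proj₂ (proj₂ (◁-extends a◁b)) m m∈a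
    ... | c , c∈b , p = subst (_ε b) (selection-unique p (proj₂ (select a m))) c∈b

    -- The antichain condition keeps markers apart from the sets `f n`, which contain markers, so
    -- that a marker in `f n` can serve as a label.
    record Markers (low : M) : Set where
      field
        marker           : ℕ → M
        marker-ε         : ∀ n → marker n ε low
        marker-injective : ∀ {i j} → marker i ≡ marker j → i ≡ j
        marker-antichain : ∀ i j → ¬ (marker i ε marker j)

    -- For a descending sequence rₙ inside x, the sets rₙ ∪ {x} form an antichain:
    -- each has x as an element, and x lies in no element of x ∪ {x}.
    markers : ∀ {a x b} → a ◁ x → x ◁ b → Markers b
    markers {a} {x} {b} a◁x x◁b = record
      { marker = λ n → adj (r n) x
      -- Adjunction needs `r n` and `x` in one set, and `x` is an element of `y`.
      ; marker-ε = λ n → let (y , x◁y , y◁b) = ◁-dense x◁b in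
          adj-ε y◁b (◁⇒⊆ x◁y _ (◁⇒ε (r◁x n))) (◁⇒ε x◁y)
      ; marker-injective = injective
      ; marker-antichain = λ i j → antichain i j ∘ ∈adj⁻ }
      where
      below : ℕ → ∃[ r ] (a ◁ r × r ◁ x)
      below zero    = ◁-dense a◁x
      below (suc n) = let (r , a◁r , r◁x) = below n ; (s , a◁s , s◁r) = ◁-dense a◁r
                      in s , a◁s , ◁-trans s◁r r◁x
      r : ℕ → M
      r = proj₁ ∘ below
      r◁x : ∀ n → r n ◁ x
      r◁x = proj₂ ∘ proj₂ ∘ below
      r-step : ∀ n → r (suc n) ◁ r n
      r-step n = proj₂ (proj₂ (◁-dense (proj₁ (proj₂ (below n)))))
      descending : ∀ {i} j → i < j → r j ◁ r i
      descending (suc j) i<1+j with m<1+n⇒m<n∨m≡n i<1+j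
      ... | inj₁ i<j  = ◁-trans (r-step j) (descending j i<j)
      ... | inj₂ refl = r-step j
      distinct : ∀ {i j} → i < j → adj (r i) x ≢ adj (r j) x
      distinct {i} {j} i<j m≡
        with ∈adj⁻ (subst (r j ε_) m≡ (∈adjˡ (◁⇒ε (descending j i<j))))
      ... | inj₁ rj∈rj = ε-irrefl rj∈rj
      ... | inj₂ rj≡x  = ε-irrefl (subst (_ε x) rj≡x (◁⇒ε (r◁x j)))
      injective : ∀ {i j} → adj (r i) x ≡ adj (r j) x → i ≡ j
      injective {i} {j} m≡ with <-cmp i j
      ... | tri< i<j _ _ = contradiction m≡ (distinct i<j)
      ... | tri≈ _ i≡j _ = i≡j
      ... | tri> _ _ j<i = contradiction (sym m≡) (distinct j<i)
      antichain : ∀ i j → ¬ (adj (r i) x ε r j ⊎ adj (r i) x ≡ x)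
      antichain i j (inj₁ h)  = ε-asym ∈adjʳ (◁⇒⊆ (r◁x j) _ h)
      antichain i j (inj₂ m≡) = ε-irrefl (subst (x ε_) m≡ ∈adjʳ)

    -- The sets `f n` and the recovery of edges from membership.

    module Embedding
      (E : Rel ℕ 0ℓ) (acyclic : Acyclic E) {low : M} (ms : Markers low)
      (U : ℕ → M) (low◁U : ∀ n → low ◁ U n) (U-mono : ∀ {i j} → E i j → U i ◁ U j)
      where

      open Markers ms

      adj-if : Set → M → M → M
      adj-if P z y = if does (em {P}) then adj z y else z

      ∈adj-if⁻ : ∀ P {x z y} → x ε adj-if P z y → x ε z ⊎ (P × x ≡ y)
      ∈adj-if⁻ P h with em {P}
      ... | no _  = inj₁ h
      ... | yes p with ∈adj⁻ h
      ... | inj₁ x∈z = inj₁ x∈z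
      ... | inj₂ x≡  = inj₂ (p , x≡)

      ∈adj-ifˡ : ∀ P {x z y} → x ε z → x ε adj-if P z y
      ∈adj-ifˡ P h with em {P}
      ... | no _  = h
      ... | yes _ = ∈adjˡ h

      ∈adj-ifʳ : ∀ {P z y} → P → y ε adj-if P z y
      ∈adj-ifʳ {P} p with em {P}
      ... | no ¬p = contradiction p ¬p
      ... | yes _ = ∈adjʳ

      -- approx n k is f n with the indices i restricted to i < k.
      approx : ℕ → ℕ → M
      approx n zero    = adj (sel (U n) (marker n)) (marker n)
      approx n (suc k) = adj-if (E n k) (adj-if (E k n) (approx n k) (approx k k)) (marker k)

      f : ℕ → M
      f n = approx n n

      data Origin (n k : ℕ) (x : M) : Set where
        generic : x ε U n → marker n ε x → Origin n k x
        own     : x ≡ marker n → Origin n k x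
        source  : ∀ {i} → i < k → E i n → x ≡ f i → Origin n k x
        target  : ∀ {i} → i < k → E n i → x ≡ marker i → Origin n k x

      origin-suc : ∀ {n k x} → Origin n k x → Origin n (suc k) x
      origin-suc (generic p q)    = generic p q
      origin-suc (own x≡)         = own x≡
      origin-suc (source i<k e p) = source (m<n⇒m<1+n i<k) e p
      origin-suc (target i<k e p) = target (m<n⇒m<1+n i<k) e p

      origin : ∀ n k {x} → x ε approx n k → Origin n k x
      origin n zero h with ∈adj⁻ h
      ... | inj₁ x∈sel = uncurry generic (proj₁ (proj₂ (select (U n) (marker n))) _ x∈sel)
      ... | inj₂ x≡    = own x≡
      origin n (suc k) h with ∈adj-if⁻ (E n k) h
      ... | inj₂ (e , x≡) = target (n<1+n k) e x≡
      ... | inj₁ h′ with ∈adj-if⁻ (E k n) h′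
      ... | inj₂ (e , x≡) = source (n<1+n k) e x≡
      ... | inj₁ h″       = origin-suc (origin n k h″)

      origin⁻¹ : ∀ n k {x} → Origin n k x → x ε approx n k
      origin⁻¹ n zero (generic x∈U m∈x) =
        ∈adjˡ (proj₂ (proj₂ (select (U n) (marker n))) _ x∈U m∈x)
      origin⁻¹ n zero (own refl) = ∈adjʳ
      origin⁻¹ n (suc k) {x} o = go o
        where
        lift : Origin n k x → x ε approx n (suc k)
        lift = ∈adj-ifˡ (E n k) ∘ ∈adj-ifˡ (E k n) ∘ origin⁻¹ n k
        go : Origin n (suc k) x → x ε approx n (suc k)
        go (generic p q) = lift (generic p q)
        go (own x≡)      = lift (own x≡)
        go (source i<k e x≡) with m<1+n⇒m<n∨m≡n i<k
        ... | inj₁ i<k′ = lift (source i<k′ e x≡)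
        go (source _ e refl) | inj₂ refl = ∈adj-ifˡ (E n k) (∈adj-ifʳ e)
        go (target i<k e x≡) with m<1+n⇒m<n∨m≡n i<k
        ... | inj₁ i<k′ = lift (target i<k′ e x≡)
        go (target _ e refl) | inj₂ refl = ∈adj-ifʳ e

      adj-if-ε : ∀ {P a b z y} → a ◁ b → z ε a → (P → y ε a) → adj-if P z y ε b
      adj-if-ε {P} a◁b z∈a y∈a with em {P}
      ... | no _  = ◁⇒⊆ a◁b _ z∈a
      ... | yes p = adj-ε a◁b z∈a (y∈a p)

      marker-ε-U : ∀ i n → marker i ε U n
      marker-ε-U i n = ◁⇒⊆ (low◁U n) _ (marker-ε i)

      -- Each adjunction or selection uses up one interval, and density supplies as many as needed.
      -- A source `f k` fits in as well, since an edge from `k` to `n` gives `U k ◁ U n`.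
      approx-ε : ∀ n k {v} → U n ◁ v → approx n k ε v
      approx-ε n zero U◁v =
        let (r , U◁r , r◁v) = ◁-dense U◁v
            m∈U = marker-ε-U n n
        in adj-ε r◁v (sel-ε U◁r m∈U) (◁⇒⊆ U◁r _ m∈U)
      approx-ε n (suc k) U◁v =
        let (s , U◁s , s◁v) = ◁-dense U◁v
            (r , U◁r , r◁s) = ◁-dense U◁s
        in adj-if-ε s◁v
             (adj-if-ε r◁s (approx-ε n k U◁r)
               (λ e → approx-ε k k (◁-trans (U-mono e) U◁r)))
             (λ _ → ◁⇒⊆ U◁s _ (marker-ε-U k n))

      f≢marker : ∀ i j → f i ≢ marker j
      f≢marker i j f≡ =
        marker-antichain i j (subst (marker i ε_) f≡ (origin⁻¹ i i (own refl)))

      -- A generic element contains `marker n`, which no marker does, and a source is never a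
      -- marker. Only the own marker and targets remain.
      marker-ε-f : ∀ i n → marker i ε f n → i ≡ n ⊎ (i < n × E n i)
      marker-ε-f i n h with origin n n h
      ... | generic _ m∈m  = contradiction m∈m (marker-antichain n i)
      ... | own x≡         = inj₁ (marker-injective x≡)
      ... | source {j} _ _ x≡ = contradiction (sym x≡) (f≢marker j i)
      ... | target j<n e x≡ with marker-injective x≡
      ... | refl = inj₂ (j<n , e)

      f-injective : ∀ i j → f i ≡ f j → i ≡ j
      f-injective i j f≡
        with marker-ε-f i j (subst (marker i ε_) f≡ (origin⁻¹ i i (own refl)))
           | marker-ε-f j i (subst (marker j ε_) (sym f≡) (origin⁻¹ j j (own refl)))
      ... | inj₁ i≡j | _ = i≡j
      ... | inj₂ _ | inj₁ j≡i = sym j≡i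
      ... | inj₂ (i<j , _) | inj₂ (j<i , _) = contradiction (<-trans i<j j<i) (<-irrefl refl)

      f-mono : ∀ i j → E i j → f i ε f j
      f-mono i j e with <-cmp i j
      ... | tri< i<j _ _  = origin⁻¹ j j (source i<j e refl)
      ... | tri≈ _ refl _ = ⊥-elim (acyclic i [ e ])
      -- A backward edge: `f i` lies in `U j` and holds `marker j` as a target, so it is generic in
      -- `f j`.
      ... | tri> _ _ j<i  =
        origin⁻¹ j j (generic (approx-ε i i (U-mono e)) (origin⁻¹ i i (target j<i e refl)))

      f-cancel : ∀ i j → f i ε f j → E i j
      f-cancel i j h with origin j j h
      ... | own x≡           = contradiction x≡ (f≢marker i j)
      ... | target {k} _ _ x≡ = contradiction x≡ (f≢marker i k)
      ... | source {k} _ e x≡ = subst (λ l → E l j) (sym (f-injective i k x≡)) e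
      -- Now `marker j` is in `f i`: either `i` and `j` agree, against irreflexivity, or a backward
      -- edge put it there.
      ... | generic _ m∈f with marker-ε-f j i m∈f
      ... | inj₁ refl    = contradiction h ε-irrefl
      ... | inj₂ (_ , e) = e

    -- Assembling the embedding.

    gap-universal : ∀ {a b} → a ◁ b → (E : Rel ℕ 0ℓ) → Acyclic E → E ↪ _ε_
    gap-universal a◁b E acyclic =
      -- The gap is cut in three: the first two intervals produce the markers inside `low`, the
      -- third one houses all `U n`.
      let (x , a◁x , x◁b)       = ◁-dense a◁b
          (low , x◁low , low◁b) = ◁-dense x◁b
      in chain-universal a◁x x◁low low◁b
      where
      chain-universal : ∀ {a x low b} → a ◁ x → x ◁ low → low ◁ b → E ↪ _ε_
      chain-universal a◁x x◁low low◁b = f , f-injective , f-mono , f-cancel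
        where
        open DenseOrder em _◁_ ◁-trans ◁-dense low◁b E acyclic
        open Embedding E acyclic (markers a◁x x◁low) embed ⊥≺embed embed-mono

  ℕ-universal : IllFounded _ε_ → (E : Rel ℕ 0ℓ) → Acyclic E → E ↪ _ε_
  ℕ-universal ill =
    let (c , ¬acc)            = ¬∀⇒∃¬ em ill
        (T , c∈T , T-trans)   = transitive-superset c
        (b , w , w-good , gap) = gap-exists T-trans c c∈T T (λ _ → id)
    in IllFoundedGaps.gap-universal w-good (c , b , ¬acc , gap , λ _ → id)

corollary29 : ExcludedMiddle 0ℓ →
    (M : Set) (_ε_ : Rel M 0ℓ) →
    IsKPModel _ε_ → Countable M → IllFounded _ε_ →
    (G : Set) (_⇀_ : Rel G 0ℓ) →
    Countable G → Acyclic _⇀_ →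
    IsomorphicToSubmodel _⇀_ _ε_
corollary29 em M _ε_ kp _ ill G _⇀_ count acyclic =
  let (E , E-acyclic , ⇀↪E) = countable-acyclic count acyclic
  in ↪⇒submodel {S = _ε_} (↪-trans {T = _ε_} ⇀↪E (KP.ℕ-universal em _ε_ kp ill E E-acyclic))
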